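{- Let $P=(X,\prec)$ be a finite poset with $|X|=n$, let $X=Y\sqcup Z$ be a partition, and let $t\ge1$ be an integer. Let $A$ be the set of pairs $(u,v)$ with $u\prec v$ and either $u,v\in Y$ or $u,v\in Z$. Let $C$ and $C'$ be sets of pairs $(y,z)$ with $y\in Y$ and $z\in Z$. Then, coefficient-wise as polynomials in $q$, $$\Omega_q(C\cup C'\cup A,t)\cdot\Omega_q(A,t)\ \geqslant_q\ \Omega_q(C\cup A,t)\cdot\Omega_q(C'\cup A,t).$$
   Context: For a set $R$ of ordered pairs of elements of $X$, $\Omega_q(R,t):=\sum_g q^{|g|-n}$, where the sum is over all maps $g:X\to[t]$ such that $g(u)\le g(v)$ for every $(u,v)\in R$, and $|g|:=\sum_{x\in X}g(x)$. (In the paper's language, $C,C'$ are $Y$-minimizing collections and the union of constraint sets corresponds to intersecting the corresponding collections.) $\geqslant_q$ means every coefficient of the difference is nonnegative. -}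

module Defs where

open import Data.Nat using (ℕ; zero; suc; _+_; _*_; _≤_; _≤ᵇ_)
open import Data.Bool using (Bool; true; false; _∧_; _∨_; not; if_then_else_)
open import Data.Fin using (Fin; toℕ)
import Data.Fin as F
open import Data.List using (List; []; _∷_; map; foldr; filterᵇ; concatMap; replicate; _++_)
open import Data.List using (allFin)
open import Data.Vec.Functional using () renaming (_∷_ to _∷ᶠ_)
open import Data.Product using (_×_)
open import Relation.Binary.PropositionalEquality using (_≡_)

-- Polynomials in q with natural-number coefficients, as coefficient
-- lists (lowest degree first).

Poly : Set
Poly = List ℕ

_+ₚ_ : Poly → Poly → Poly
[] +ₚ q = q
(a ∷ p) +ₚ [] = a ∷ p
(a ∷ p) +ₚ (b ∷ q) = (a + b) ∷ (p +ₚ q)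

scale : ℕ → Poly → Poly
scale c = map (c *_)

_*ₚ_ : Poly → Poly → Poly
[] *ₚ q = []
(a ∷ p) *ₚ q = scale a q +ₚ (0 ∷ (p *ₚ q))

mono : ℕ → Poly
mono m = replicate m 0 ++ (1 ∷ [])

coeff : Poly → ℕ → ℕ
coeff [] k = 0
coeff (a ∷ p) zero = a
coeff (a ∷ p) (suc k) = coeff p k

_≥q_ : Poly → Poly → Set
P ≥q Q = ∀ k → coeff Q k ≤ coeff P k

-- Maps X → [t], with X = Fin n.  A value i : Fin t encodes the element
-- toℕ i + 1 of [t] = {1,…,t}.

allMaps : (n t : ℕ) → List (Fin n → Fin t)
allMaps zero t = (λ ()) ∷ []
allMaps (suc n) t = concatMap (λ a → map (λ g → a ∷ᶠ g) (allMaps n t)) (allFin t)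

-- |g| - n  =  Σ_x (toℕ (g x) + 1) - n  =  Σ_x toℕ (g x)
weight : {n t : ℕ} → (Fin n → Fin t) → ℕ
weight {zero} g = 0
weight {suc n} g = toℕ (g F.zero) + weight (λ i → g (F.suc i))

andL : List Bool → Bool
andL = foldr _∧_ true

respects : {n t : ℕ} → (Fin n → Fin n → Bool) → (Fin n → Fin t) → Bool
respects {n} R g =
  andL (concatMap (λ u → map (λ v → not (R u v) ∨ (toℕ (g u) ≤ᵇ toℕ (g v))) (allFin n)) (allFin n))

Ωq : {n : ℕ} → (Fin n → Fin n → Bool) → (t : ℕ) → Poly
Ωq {n} R t = foldr _+ₚ_ [] (map (λ g → mono (weight g)) (filterᵇ (respects R) (allMaps n t)))

_∪ᵣ_ : {n : ℕ} → (Fin n → Fin n → Bool) → (Fin n → Fin n → Bool) → (Fin n → Fin n → Bool)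
(R ∪ᵣ S) u v = R u v ∨ S u v

{-# OPTIONS --safe #-}

-- Fix two maps f, g and swap their values at arbitrary points: every pair obtained this
-- way has the same total weight, so it suffices to compare the two sides on each such family.
-- Order the two values at each point increasingly on Y and decreasingly on Z, so that a pair
-- in the family is a vector S of bits, its mirror image being the complement of S.
-- The S for which both maps respect A form a Boolean subalgebra D of the cube, and C, C'
-- cut out ideals U, V of D. What remains is that there are at most as many S with S ∈ U and
-- ¬ S ∈ V as there are S in U ∩ V, which follows by induction on the dimension from
-- u₁v₀ + u₀v₁ ≤ u₀v₀ + u₁v₁ for u₁ ≤ u₀ and v₁ ≤ v₀.
module Submission where

open import Defs
open import Data.Nat using (ℕ; zero; suc; _+_; _*_; _^_; _≤_; _≤ᵇ_; z≤n; s≤s)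
open import Data.Nat.Properties hiding (_≟_)
open import Data.Nat.Solver using (module +-*-Solver)
open import Data.Nat.ListAction using (sum)
open import Data.Nat.ListAction.Properties using (sum-++)
open import Data.Bool using (Bool; true; false; not; _∧_; _∨_; _xor_; if_then_else_)
open import Data.Bool.Properties using (_≟_; not-involutive; not-¬; T-≡; ∨-zeroʳ; ∧-sel)
open import Data.Fin using (Fin; toℕ)
import Data.Fin as F
open import Data.List using (List; []; _∷_; _++_; map; foldr; filterᵇ; concatMap; allFin)
open import Data.List.Properties using (map-++; map-∘; map-cong)
open import Data.List.Relation.Unary.Any using (here; there)
open import Data.List.Membership.Propositional using (_∈_)
open import Data.List.Membership.Propositional.Properties using (∈-allFin)
open import Data.Vec using (Vec; lookup; zipWith; replicate) renaming ([] to []ᵥ; _∷_ to _∷ᵥ_; map to mapᵥ)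
open import Data.Vec.Properties using (lookup-map; lookup-zipWith)
open import Data.Vec.Functional using () renaming (_∷_ to _∷ᶠ_)
open import Data.Product using (_×_; _,_; proj₁; proj₂)
open import Data.Sum using (_⊎_; inj₁; inj₂)
open import Data.Empty using (⊥)
open import Function using (_∘_; Equivalence)
open import Relation.Nullary using (¬_)
open import Relation.Binary.Core using (Rel)
open import Level using (0ℓ)
open import Relation.Binary.Definitions using (Decidable)
open import Relation.Binary.Structures using (IsStrictPartialOrder)
open import Relation.Binary.PropositionalEquality using (_≡_; refl; sym; trans; cong; cong₂; subst; subst₂; module ≡-Reasoning)
open import Relation.Nullary.Decidable using (⌊_⌋; toWitness)

private variable
  X Z : Set
  n t : ℕ

-- Finite sums

private
  interchange : ∀ a b c d → (a + b) + (c + d) ≡ (a + c) + (b + d)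
  interchange = solve 4 (λ a b c d → (a :+ b) :+ (c :+ d) := (a :+ c) :+ (b :+ d)) refl
    where open +-*-Solver

∑ : List X → (X → ℕ) → ℕ
∑ xs f = sum (map f xs)

∑-cong : (xs : List X) {f g : X → ℕ} → (∀ x → f x ≡ g x) → ∑ xs f ≡ ∑ xs g
∑-cong xs f≗g = cong sum (map-cong f≗g xs)

∑-mono : (xs : List X) {f g : X → ℕ} → (∀ x → f x ≤ g x) → ∑ xs f ≤ ∑ xs g
∑-mono [] f≤g = z≤n
∑-mono (x ∷ xs) f≤g = +-mono-≤ (f≤g x) (∑-mono xs f≤g)

∑-zero : (xs : List X) → ∑ xs (λ _ → 0) ≡ 0
∑-zero [] = refl
∑-zero (x ∷ xs) = ∑-zero xs

∑-+ : (xs : List X) (f g : X → ℕ) → ∑ xs (λ x → f x + g x) ≡ ∑ xs f + ∑ xs g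
∑-+ [] f g = refl
∑-+ (x ∷ xs) f g rewrite ∑-+ xs f g = interchange (f x) (g x) (∑ xs f) (∑ xs g)

∑-*ˡ : (c : ℕ) (xs : List X) (f : X → ℕ) → ∑ xs (λ x → c * f x) ≡ c * ∑ xs f
∑-*ˡ c [] f = sym (*-zeroʳ c)
∑-*ˡ c (x ∷ xs) f rewrite ∑-*ˡ c xs f = sym (*-distribˡ-+ c (f x) (∑ xs f))

∑-*ʳ : (c : ℕ) (xs : List X) (f : X → ℕ) → ∑ xs (λ x → f x * c) ≡ ∑ xs f * c
∑-*ʳ c xs f = trans (∑-cong xs (λ x → *-comm (f x) c)) (trans (∑-*ˡ c xs f) (*-comm c (∑ xs f)))

∑-swap : (xs : List X) (zs : List Z) (f : X → Z → ℕ) →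
  ∑ xs (λ x → ∑ zs (f x)) ≡ ∑ zs (λ z → ∑ xs (λ x → f x z))
∑-swap [] zs f = sym (∑-zero zs)
∑-swap (x ∷ xs) zs f rewrite ∑-swap xs zs f = sym (∑-+ zs (f x) (λ z → ∑ xs (λ x → f x z)))

∑-++ : (xs ys : List X) (f : X → ℕ) → ∑ (xs ++ ys) f ≡ ∑ xs f + ∑ ys f
∑-++ xs ys f = trans (cong sum (map-++ f xs ys)) (sum-++ (map f xs) (map f ys))

∑-map : (h : Z → X) (zs : List Z) (f : X → ℕ) → ∑ (map h zs) f ≡ ∑ zs (f ∘ h)
∑-map h zs f = cong sum (sym (map-∘ zs))

∑-concatMap : (h : Z → List X) (zs : List Z) (f : X → ℕ) → ∑ (concatMap h zs) f ≡ ∑ zs (λ z → ∑ (h z) f)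
∑-concatMap h [] f = refl
∑-concatMap h (z ∷ zs) f = trans (∑-++ (h z) (concatMap h zs) f) (cong (∑ (h z) f +_) (∑-concatMap h zs f))

∑-allMaps : (f : (Fin (suc n) → Fin t) → ℕ) →
  ∑ (allMaps (suc n) t) f ≡ ∑ (allFin t) (λ a → ∑ (allMaps n t) (λ g → f (a ∷ᶠ g)))
∑-allMaps {n} {t} f = trans (∑-concatMap (λ a → map (a ∷ᶠ_) (allMaps n t)) (allFin t) f)
  (∑-cong (allFin t) (λ a → ∑-map (a ∷ᶠ_) (allMaps n t) f))

𝟙 : Bool → ℕ
𝟙 true = 1
𝟙 false = 0

-- Coefficients of products

coeff-+ₚ : ∀ p q k → coeff (p +ₚ q) k ≡ coeff p k + coeff q k
coeff-+ₚ [] q k = refl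
coeff-+ₚ (a ∷ p) [] k = sym (+-identityʳ _)
coeff-+ₚ (a ∷ p) (b ∷ q) zero = refl
coeff-+ₚ (a ∷ p) (b ∷ q) (suc k) = coeff-+ₚ p q k

coeff-scale : ∀ c p k → coeff (scale c p) k ≡ c * coeff p k
coeff-scale c [] k = sym (*-zeroʳ c)
coeff-scale c (a ∷ p) zero = refl
coeff-scale c (a ∷ p) (suc k) = coeff-scale c p k

coeff-∷-*ₚ : ∀ a p q k → coeff ((a ∷ p) *ₚ q) k ≡ a * coeff q k + coeff (0 ∷ (p *ₚ q)) k
coeff-∷-*ₚ a p q k =
  trans (coeff-+ₚ (scale a q) (0 ∷ (p *ₚ q)) k) (cong (_+ coeff (0 ∷ (p *ₚ q)) k) (coeff-scale a q k))

*ₚ-distribʳ : ∀ p p′ q k → coeff ((p +ₚ p′) *ₚ q) k ≡ coeff (p *ₚ q) k + coeff (p′ *ₚ q) k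
*ₚ-distribʳ [] p′ q k = refl
*ₚ-distribʳ (a ∷ p) [] q k = sym (+-identityʳ _)
*ₚ-distribʳ (a ∷ p) (b ∷ p′) q k
  rewrite coeff-∷-*ₚ (a + b) (p +ₚ p′) q k | coeff-∷-*ₚ a p q k | coeff-∷-*ₚ b p′ q k = lemma k
  where
  open +-*-Solver
  lemma : ∀ k → (a + b) * coeff q k + coeff (0 ∷ ((p +ₚ p′) *ₚ q)) k
    ≡ (a * coeff q k + coeff (0 ∷ (p *ₚ q)) k) + (b * coeff q k + coeff (0 ∷ (p′ *ₚ q)) k)
  lemma zero =
    solve 3 (λ a b c → (a :+ b) :* c :+ con 0 := (a :* c :+ con 0) :+ (b :* c :+ con 0)) refl a b (coeff q 0)
  lemma (suc k) rewrite *ₚ-distribʳ p p′ q k =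
    solve 5 (λ a b c d e → (a :+ b) :* c :+ (d :+ e) := (a :* c :+ d) :+ (b :* c :+ e)) refl
      a b (coeff q (suc k)) (coeff (p *ₚ q) k) (coeff (p′ *ₚ q) k)

mono-zero-*ₚ : ∀ q k → coeff (mono 0 *ₚ q) k ≡ coeff q k
mono-zero-*ₚ q k = trans (coeff-∷-*ₚ 1 [] q k)
  (trans (cong₂ _+_ (*-identityˡ (coeff q k)) (coeff-0 k)) (+-identityʳ _))
  where
  coeff-0 : ∀ k → coeff (0 ∷ []) k ≡ 0
  coeff-0 zero = refl
  coeff-0 (suc k) = refl

mono-suc-*ₚ : ∀ a q k → coeff (mono (suc a) *ₚ q) k ≡ coeff (0 ∷ (mono a *ₚ q)) k
mono-suc-*ₚ a q k = coeff-∷-*ₚ 0 (mono a) q k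

mono-*ₚ-[] : ∀ a k → coeff (mono a *ₚ []) k ≡ 0
mono-*ₚ-[] zero k = mono-zero-*ₚ [] k
mono-*ₚ-[] (suc a) zero = refl
mono-*ₚ-[] (suc a) (suc k) = mono-*ₚ-[] a k

-- Induction on the exponent: each step shifts both sides by one degree. The left factor is a
-- monomial because `coeff-Ωq-*ₚ` expands the left factor of the product first.
mono-*ₚ-distribˡ : ∀ a q q′ k → coeff (mono a *ₚ (q +ₚ q′)) k ≡ coeff (mono a *ₚ q) k + coeff (mono a *ₚ q′) k
mono-*ₚ-distribˡ zero q q′ k
  rewrite mono-zero-*ₚ (q +ₚ q′) k | mono-zero-*ₚ q k | mono-zero-*ₚ q′ k = coeff-+ₚ q q′ k
mono-*ₚ-distribˡ (suc a) q q′ k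
  rewrite mono-suc-*ₚ a (q +ₚ q′) k | mono-suc-*ₚ a q k | mono-suc-*ₚ a q′ k = lemma k
  where
  lemma : ∀ k → coeff (0 ∷ (mono a *ₚ (q +ₚ q′))) k ≡ coeff (0 ∷ (mono a *ₚ q)) k + coeff (0 ∷ (mono a *ₚ q′)) k
  lemma zero = refl
  lemma (suc k) = mono-*ₚ-distribˡ a q q′ k

mono-*ₚ-mono : ∀ a b k → coeff (mono a *ₚ mono b) k ≡ coeff (mono (a + b)) k
mono-*ₚ-mono zero b k = mono-zero-*ₚ (mono b) k
mono-*ₚ-mono (suc a) b k = trans (mono-suc-*ₚ a (mono b) k) (lemma k)
  where
  lemma : ∀ k → coeff (0 ∷ (mono a *ₚ mono b)) k ≡ coeff (mono (suc a + b)) k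
  lemma zero = refl
  lemma (suc k) = mono-*ₚ-mono a b k

∑ₚ : (X → Bool) → (X → Poly) → List X → Poly
∑ₚ r p xs = foldr _+ₚ_ [] (map p (filterᵇ r xs))

-- A coefficient of a product is additive in each factor separately, so this applies twice: with `φ`
-- varying the left factor, then with `φ` varying the right factor next to a fixed monomial.
linear-∑ₚ : (φ : Poly → ℕ) → φ [] ≡ 0 → (∀ p q → φ (p +ₚ q) ≡ φ p + φ q) →
  (r : X → Bool) (p : X → Poly) (xs : List X) → φ (∑ₚ r p xs) ≡ ∑ xs (λ x → 𝟙 (r x) * φ (p x))
linear-∑ₚ φ φ-[] φ-+ r p [] = φ-[]
linear-∑ₚ φ φ-[] φ-+ r p (x ∷ xs) with r x
... | false = linear-∑ₚ φ φ-[] φ-+ r p xs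
... | true = trans (φ-+ (p x) (∑ₚ r p xs))
  (cong₂ _+_ (sym (*-identityˡ (φ (p x)))) (linear-∑ₚ φ φ-[] φ-+ r p xs))

-- Brings both sides of the theorem to sums over the same pairs of maps, in which the constraints
-- enter only through 0/1 factors.
coeff-Ωq-*ₚ : (R S : Fin n → Fin n → Bool) (t k : ℕ) → coeff (Ωq R t *ₚ Ωq S t) k ≡
  ∑ (allMaps n t) (λ f → ∑ (allMaps n t) (λ g →
    𝟙 (respects R f) * (𝟙 (respects S g) * coeff (mono (weight f + weight g)) k)))
coeff-Ωq-*ₚ {n} R S t k = trans
  (linear-∑ₚ (λ p → coeff (p *ₚ Ωq S t) k) refl (λ p p′ → *ₚ-distribʳ p p′ (Ωq S t) k)
    (respects R) (mono ∘ weight) (allMaps n t))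
  (∑-cong (allMaps n t) (λ f → trans
    (cong (𝟙 (respects R f) *_) (trans
      (linear-∑ₚ (λ q → coeff (mono (weight f) *ₚ q) k) (mono-*ₚ-[] (weight f) k)
        (λ q q′ → mono-*ₚ-distribˡ (weight f) q q′ k) (respects S) (mono ∘ weight) (allMaps n t))
      (∑-cong (allMaps n t) (λ g → cong (𝟙 (respects S g) *_) (mono-*ₚ-mono (weight f) (weight g) k)))))
    (sym (∑-*ˡ (𝟙 (respects R f)) (allMaps n t) _))))

-- Ideals of a Boolean subalgebra of the cube

∧-true : ∀ {a b} → a ∧ b ≡ true → a ≡ true × b ≡ true
∧-true {true} {true} _ = refl , refl

true-∧ : ∀ {a b} → a ≡ true → b ≡ true → a ∧ b ≡ true
true-∧ refl refl = refl

∨-true : ∀ {a b} → a ∨ b ≡ true → a ≡ true ⊎ b ≡ true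
∨-true {true} _ = inj₁ refl
∨-true {false} p = inj₂ p

true-∨ˡ : ∀ {a b} → a ≡ true → a ∨ b ≡ true
true-∨ˡ refl = refl

true-∨ʳ : ∀ {a b} → b ≡ true → a ∨ b ≡ true
true-∨ʳ {a} refl = ∨-zeroʳ a

Bits : ℕ → Set
Bits = Vec Bool

infixr 6 _∧ᵥ_

_∧ᵥ_ : Bits n → Bits n → Bits n
_∧ᵥ_ = zipWith _∧_

¬ᵥ_ : Bits n → Bits n
¬ᵥ_ = mapᵥ not

∧ᵥ-identityˡ : (S : Bits n) → replicate n true ∧ᵥ S ≡ S
∧ᵥ-identityˡ []ᵥ = refl
∧ᵥ-identityˡ (s ∷ᵥ S) = cong (s ∷ᵥ_) (∧ᵥ-identityˡ S)

∧ᵥ-inverseʳ : (S : Bits n) → S ∧ᵥ ¬ᵥ S ≡ replicate n false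
∧ᵥ-inverseʳ []ᵥ = refl
∧ᵥ-inverseʳ (true ∷ᵥ S) = cong (false ∷ᵥ_) (∧ᵥ-inverseʳ S)
∧ᵥ-inverseʳ (false ∷ᵥ S) = cong (false ∷ᵥ_) (∧ᵥ-inverseʳ S)

¬ᵥ-involutive : (S : Bits n) → ¬ᵥ (¬ᵥ S) ≡ S
¬ᵥ-involutive []ᵥ = refl
¬ᵥ-involutive (s ∷ᵥ S) = cong₂ _∷ᵥ_ (not-involutive s) (¬ᵥ-involutive S)

¬ᵥ-replicate : ∀ n → ¬ᵥ replicate n false ≡ replicate n true
¬ᵥ-replicate zero = refl
¬ᵥ-replicate (suc n) = cong (true ∷ᵥ_) (¬ᵥ-replicate n)

allBits : (n : ℕ) → List (Bits n)
allBits zero = []ᵥ ∷ []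
allBits (suc n) = map (true ∷ᵥ_) (allBits n) ++ map (false ∷ᵥ_) (allBits n)

∑-allBits : (f : Bits (suc n) → ℕ) →
  ∑ (allBits (suc n)) f ≡ ∑ (allBits n) (f ∘ (true ∷ᵥ_)) + ∑ (allBits n) (f ∘ (false ∷ᵥ_))
∑-allBits {n} f = trans (∑-++ (map (true ∷ᵥ_) (allBits n)) _ f)
  (cong₂ _+_ (∑-map (true ∷ᵥ_) (allBits n) f) (∑-map (false ∷ᵥ_) (allBits n) f))

-- There is no unit axiom, so `D` may be empty. This happens in `Fibre` when no choice of bits makes
-- both maps respect `A`.
record IsSubalgebra (D : Bits n → Bool) : Set where
  field
    ∧-closed : ∀ {S T} → D S ≡ true → D T ≡ true → D (S ∧ᵥ T) ≡ true
    ¬-closed : ∀ {S} → D S ≡ true → D (¬ᵥ S) ≡ true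

-- For a subalgebra `D` these are exactly its down-sets: a member `S` of `D` below `T` equals
-- `S ∧ᵥ T`, so `absorb` carries membership from `T` down to `S`.
record IsIdeal (D U : Bits n → Bool) : Set where
  field
    ⊆-D : ∀ {S} → U S ≡ true → D S ≡ true
    absorb : ∀ {S T} → D S ≡ true → U T ≡ true → U (S ∧ᵥ T) ≡ true

open IsSubalgebra
open IsIdeal

face : Bool → (Bits (suc n) → Bool) → Bits n → Bool
face b D S = D (b ∷ᵥ S)

atom : ∀ n → Bits (suc n)
atom n = true ∷ᵥ replicate n false

-- If D contains the atom of the first coordinate then D is a product with the cube of dimension
-- one; otherwise the projection forgetting the first coordinate is injective on D.

module WithAtom {D : Bits (suc n) → Bool} (alg : IsSubalgebra D) (atom∈ : D (atom n) ≡ true) where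

  coatom∈ : D (false ∷ᵥ replicate n true) ≡ true
  coatom∈ = subst (λ S → D (false ∷ᵥ S) ≡ true) (¬ᵥ-replicate n) (¬-closed alg atom∈)

  -- Meeting with the complement of the atom clears the first bit and keeps all others.
  lower : ∀ {U b S} → IsIdeal D U → U (b ∷ᵥ S) ≡ true → U (false ∷ᵥ S) ≡ true
  lower {U} {S = S} ideal u = subst (λ S → U (false ∷ᵥ S) ≡ true) (∧ᵥ-identityˡ S) (absorb ideal coatom∈ u)

  D-ideal : IsIdeal D D
  D-ideal = record { ⊆-D = λ d → d ; absorb = ∧-closed alg }

  face-subalgebra : IsSubalgebra (face false D)
  face-subalgebra = record
    { ∧-closed = ∧-closed alg
    ; ¬-closed = λ d → lower D-ideal (¬-closed alg d) }

  -- Complementing first inside the face and then in the whole cube restores the other bits and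
  -- flips the first.
  raise : ∀ {S} → D (false ∷ᵥ S) ≡ true → D (true ∷ᵥ S) ≡ true
  raise {S} d = subst (λ S → D (true ∷ᵥ S) ≡ true) (¬ᵥ-involutive S)
    (¬-closed alg (¬-closed face-subalgebra d))

  -- By `lower` and `raise` the two faces of `D` coincide, so both faces of `U` are ideals of one
  -- algebra and the induction hypothesis can mix them.
  face-ideal : ∀ {U} b → IsIdeal D U → IsIdeal (face false D) (face b U)
  face-ideal false ideal = record
    { ⊆-D = ⊆-D ideal
    ; absorb = absorb ideal }
  face-ideal true ideal = record
    { ⊆-D = λ u → ⊆-D ideal (lower ideal u)
    ; absorb = λ d u → absorb ideal (raise d) u }

module WithoutAtom {D : Bits (suc n) → Bool} (alg : IsSubalgebra D) (atom∉ : ¬ (D (atom n) ≡ true)) where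

  proj : (Bits (suc n) → Bool) → Bits n → Bool
  proj U S = U (false ∷ᵥ S) ∨ U (true ∷ᵥ S)

  proj-intro : ∀ U b {S} → U (b ∷ᵥ S) ≡ true → proj U S ≡ true
  proj-intro U false u = true-∨ˡ u
  proj-intro U true {S} u = true-∨ʳ {U (false ∷ᵥ S)} u

  data Lifts (U : Bits (suc n) → Bool) (S : Bits n) : Set where
    lift : ∀ b → U (b ∷ᵥ S) ≡ true → Lifts U S

  proj-elim : ∀ U {S} → proj U S ≡ true → Lifts U S
  proj-elim U {S} p with ∨-true {U (false ∷ᵥ S)} p
  ... | inj₁ u = lift false u
  ... | inj₂ u = lift true u

  -- If both lifts of `S` lay in `D`, the meet of one with the complement of the other would be the
  -- atom.
  disjoint : ∀ {S} → D (true ∷ᵥ S) ≡ true → D (false ∷ᵥ S) ≡ true → ⊥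
  disjoint {S} d₁ d₀ =
    atom∉ (subst (λ S → D (true ∷ᵥ S) ≡ true) (∧ᵥ-inverseʳ S) (∧-closed alg d₁ (¬-closed alg d₀)))

  proj-subalgebra : IsSubalgebra (proj D)
  proj-subalgebra .∧-closed p q with proj-elim D p | proj-elim D q
  ... | lift b d | lift c e = proj-intro D (b ∧ c) (∧-closed alg d e)
  proj-subalgebra .¬-closed p with proj-elim D p
  ... | lift b d = proj-intro D (not b) (¬-closed alg d)

  proj-ideal : ∀ {U} → IsIdeal D U → IsIdeal (proj D) (proj U)
  proj-ideal {U} ideal .⊆-D p with proj-elim U p
  ... | lift b u = proj-intro D b (⊆-D ideal u)
  proj-ideal {U} ideal .absorb p q with proj-elim D p | proj-elim U q
  ... | lift b d | lift c u = proj-intro U (b ∧ c) (absorb ideal d u)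

-- The counting inequality for two ideals

private
  -- With bits read as 0 and 1, right side minus left side is (u₀ - u₁)(v₀ - v₁), a product of two
  -- nonnegative factors.
  exchange : ∀ u₀ u₁ v₀ v₁ → (u₁ ≡ true → u₀ ≡ true) → (v₁ ≡ true → v₀ ≡ true) →
    𝟙 (u₁ ∧ v₀) + 𝟙 (u₀ ∧ v₁) ≤ 𝟙 (u₁ ∧ v₁) + 𝟙 (u₀ ∧ v₀)
  exchange u₀ true v₀ v₁ p q rewrite p refl = ≤-reflexive (+-comm (𝟙 v₀) (𝟙 v₁))
  exchange u₀ false v₀ true p q rewrite q refl = ≤-refl
  exchange true false v₀ false p q = z≤n
  exchange false false v₀ false p q = z≤n

  𝟙≤1 : ∀ b → 𝟙 b ≤ 1
  𝟙≤1 true = ≤-refl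
  𝟙≤1 false = z≤n

  -- Since `u₀` and `u₁` exclude each other, at most one summand on the left is 1.
  merge-≤ : ∀ u₀ u₁ v₀ v₁ → (u₁ ≡ true → u₀ ≡ true → ⊥) →
    𝟙 (u₁ ∧ v₀) + 𝟙 (u₀ ∧ v₁) ≤ 𝟙 ((u₀ ∨ u₁) ∧ (v₀ ∨ v₁))
  merge-≤ true true v₀ v₁ p with () ← p refl refl
  merge-≤ true false true v₁ p = 𝟙≤1 v₁
  merge-≤ true false false v₁ p = ≤-refl
  merge-≤ false true true v₁ p = ≤-refl
  merge-≤ false true false v₁ p = z≤n
  merge-≤ false false v₀ v₁ p = z≤n

  -- The hypotheses forbid the witnesses of the two disjunctions to carry different indices, so they
  -- carry the same one.
  split-≤ : ∀ u₀ u₁ v₀ v₁ → (u₁ ≡ true → v₀ ≡ true → ⊥) → (v₁ ≡ true → u₀ ≡ true → ⊥) →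
    𝟙 ((u₀ ∨ u₁) ∧ (v₀ ∨ v₁)) ≤ 𝟙 (u₁ ∧ v₁) + 𝟙 (u₀ ∧ v₀)
  split-≤ u₀ true true v₁ p q with () ← p refl refl
  split-≤ true u₁ v₀ true p q with () ← q refl refl
  split-≤ true u₁ true v₁ p q = m≤n+m 1 (𝟙 (u₁ ∧ v₁))
  split-≤ true u₁ false false p q = z≤n
  split-≤ false false v₀ v₁ p q = z≤n
  split-≤ false true false true p q = s≤s z≤n
  split-≤ false true false false p q = z≤n

-- When `D` is the full cube this is a case of Kleitman's correlation inequality: `V` is a down-set,
-- and the `S` with `¬ᵥ S` in `V` form an up-set. For general `D`, the atom decides whether the
-- first coordinate is free (split into faces) or determined by the others on `D` (project it away).
∑-complement-≤ : ∀ n {D U V : Bits n → Bool} → IsSubalgebra D → IsIdeal D U → IsIdeal D V →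
  ∑ (allBits n) (λ S → 𝟙 (U S ∧ V (¬ᵥ S))) ≤ ∑ (allBits n) (λ S → 𝟙 (U S ∧ V S))
∑-complement-≤ zero alg idU idV = ≤-refl
∑-complement-≤ (suc n) {D} {U} {V} alg idU idV
  rewrite ∑-allBits (λ S → 𝟙 (U S ∧ V (¬ᵥ S))) | ∑-allBits (λ S → 𝟙 (U S ∧ V S))
  with D (atom n) in atom-eq
... | true = begin
  Σ (λ S → 𝟙 (U₁ S ∧ V₀ (¬ᵥ S))) + Σ (λ S → 𝟙 (U₀ S ∧ V₁ (¬ᵥ S)))
    -- Complementing flips the first bit too, so each face of `U` is paired with the opposite face
    -- of `V`; `exchange` then pairs equal faces.
    ≤⟨ +-mono-≤ (∑-complement-≤ n face-subalgebra (face-ideal true idU) (face-ideal false idV))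
                (∑-complement-≤ n face-subalgebra (face-ideal false idU) (face-ideal true idV)) ⟩
  Σ (λ S → 𝟙 (U₁ S ∧ V₀ S)) + Σ (λ S → 𝟙 (U₀ S ∧ V₁ S))
    ≡⟨ ∑-+ (allBits n) _ _ ⟨
  Σ (λ S → 𝟙 (U₁ S ∧ V₀ S) + 𝟙 (U₀ S ∧ V₁ S))
    ≤⟨ ∑-mono (allBits n) (λ S → exchange (U₀ S) (U₁ S) (V₀ S) (V₁ S) (lower idU) (lower idV)) ⟩
  Σ (λ S → 𝟙 (U₁ S ∧ V₁ S) + 𝟙 (U₀ S ∧ V₀ S))
    ≡⟨ ∑-+ (allBits n) _ _ ⟩
  Σ (λ S → 𝟙 (U₁ S ∧ V₁ S)) + Σ (λ S → 𝟙 (U₀ S ∧ V₀ S)) ∎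
  where
  open ≤-Reasoning
  open WithAtom alg atom-eq
  Σ = ∑ (allBits n)
  U₀ = face false U
  U₁ = face true U
  V₀ = face false V
  V₁ = face true V
... | false = begin
  Σ (λ S → 𝟙 (U₁ S ∧ V₀ (¬ᵥ S))) + Σ (λ S → 𝟙 (U₀ S ∧ V₁ (¬ᵥ S)))
    ≡⟨ ∑-+ (allBits n) _ _ ⟨
  Σ (λ S → 𝟙 (U₁ S ∧ V₀ (¬ᵥ S)) + 𝟙 (U₀ S ∧ V₁ (¬ᵥ S)))
    ≤⟨ ∑-mono (allBits n) (λ S → merge-≤ (U₀ S) (U₁ S) (V₀ (¬ᵥ S)) (V₁ (¬ᵥ S))
         (λ u₁ u₀ → disjoint (⊆-D idU u₁) (⊆-D idU u₀))) ⟩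
  Σ (λ S → 𝟙 (proj U S ∧ proj V (¬ᵥ S)))
    ≤⟨ ∑-complement-≤ n proj-subalgebra (proj-ideal idU) (proj-ideal idV) ⟩
  Σ (λ S → 𝟙 (proj U S ∧ proj V S))
    ≤⟨ ∑-mono (allBits n) (λ S → split-≤ (U₀ S) (U₁ S) (V₀ S) (V₁ S)
         (λ u₁ v₀ → disjoint (⊆-D idU u₁) (⊆-D idV v₀))
         (λ v₁ u₀ → disjoint (⊆-D idV v₁) (⊆-D idU u₀))) ⟩
  Σ (λ S → 𝟙 (U₁ S ∧ V₁ S) + 𝟙 (U₀ S ∧ V₀ S))
    ≡⟨ ∑-+ (allBits n) _ _ ⟩
  Σ (λ S → 𝟙 (U₁ S ∧ V₁ S)) + Σ (λ S → 𝟙 (U₀ S ∧ V₀ S)) ∎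
  where
  open ≤-Reasoning
  open WithoutAtom alg (not-¬ atom-eq)
  Σ = ∑ (allBits n)
  U₀ = face false U
  U₁ = face true U
  V₀ = face false V
  V₁ = face true V

-- Swapping values of two maps

-- The larger of a and b if y and s agree, the smaller otherwise.
pick : Bool → Bool → Fin t → Fin t → Fin t
pick y s a b = if (y xor s) xor (toℕ a ≤ᵇ toℕ b) then b else a

-- Built with `∷ᶠ` as `allMaps` is, so that `∑∑-mix` can recurse on the dimension for an arbitrary
-- `H`, without assuming that `H` respects pointwise equality.
mix : (Fin n → Bool) → Bits n → (f g : Fin n → Fin t) → Fin n → Fin t
mix o []ᵥ f g = f
mix o (s ∷ᵥ S) f g = pick (o F.zero) s (f F.zero) (g F.zero) ∷ᶠ mix (o ∘ F.suc) S (f ∘ F.suc) (g ∘ F.suc)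

mix-lookup : (o : Fin n → Bool) (S : Bits n) (f g : Fin n → Fin t) (u : Fin n) →
  mix o S f g u ≡ pick (o u) (lookup S u) (f u) (g u)
mix-lookup o (s ∷ᵥ S) f g F.zero = refl
mix-lookup o (s ∷ᵥ S) f g (F.suc u) = mix-lookup (o ∘ F.suc) S (f ∘ F.suc) (g ∘ F.suc) u

-- Opposite bits select the two different arguments, so the pair of picks is (a, b) or (b, a).
pick-symmetric : {M : Set} (F : Fin t → Fin t → M) → (∀ a b → F a b ≡ F b a) →
  ∀ y s a b → F (pick y s a b) (pick y (not s) a b) ≡ F a b
pick-symmetric F F-sym y s a b with toℕ a ≤ᵇ toℕ b
pick-symmetric F F-sym true  true  a b | true  = F-sym b a
pick-symmetric F F-sym true  true  a b | false = refl
pick-symmetric F F-sym true  false a b | true  = refl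
pick-symmetric F F-sym true  false a b | false = F-sym b a
pick-symmetric F F-sym false true  a b | true  = refl
pick-symmetric F F-sym false true  a b | false = F-sym b a
pick-symmetric F F-sym false false a b | true  = F-sym b a
pick-symmetric F F-sym false false a b | false = refl

weight-mix : (o : Fin n → Bool) (S : Bits n) (f g : Fin n → Fin t) →
  weight (mix o S f g) + weight (mix o (¬ᵥ S) f g) ≡ weight f + weight g
weight-mix o []ᵥ f g = refl
weight-mix o (s ∷ᵥ S) f g = begin
  (p + w) + (p′ + w′)   ≡⟨ interchange p w p′ w′ ⟩
  (p + p′) + (w + w′)   ≡⟨ cong₂ _+_
                             (pick-symmetric (λ a b → toℕ a + toℕ b) (λ a b → +-comm (toℕ a) (toℕ b)) (o F.zero) s a b)
                             (weight-mix (o ∘ F.suc) S f′ g′) ⟩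
  (toℕ a + toℕ b) + (weight f′ + weight g′)
                        ≡⟨ interchange (toℕ a) (toℕ b) (weight f′) (weight g′) ⟩
  (toℕ a + weight f′) + (toℕ b + weight g′) ∎
  where
  open ≡-Reasoning
  a = f F.zero
  b = g F.zero
  f′ = f ∘ F.suc
  g′ = g ∘ F.suc
  p = toℕ (pick (o F.zero) s a b)
  p′ = toℕ (pick (o F.zero) (not s) a b)
  w = weight (mix (o ∘ F.suc) S f′ g′)
  w′ = weight (mix (o ∘ F.suc) (¬ᵥ S) f′ g′)

-- Averaging over all swaps

∑∑ : (n t : ℕ) → ((f g : Fin n → Fin t) → ℕ) → ℕ
∑∑ n t H = ∑ (allMaps n t) (λ f → ∑ (allMaps n t) (H f))

∑∑-suc : (H : (f g : Fin (suc n) → Fin t) → ℕ) → ∑∑ (suc n) t H ≡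
  ∑ (allFin t) (λ a → ∑ (allFin t) (λ b → ∑∑ n t (λ f g → H (a ∷ᶠ f) (b ∷ᶠ g))))
∑∑-suc {n} {t} H = trans (∑-allMaps (λ f → ∑ (allMaps (suc n) t) (H f)))
  (∑-cong (allFin t) (λ a → trans
    (∑-cong (allMaps n t) (λ f → ∑-allMaps (H (a ∷ᶠ f))))
    (∑-swap (allMaps n t) (allFin t) _)))

-- For a single `S` the map from (f, g) to its mixed pair is not a bijection, since it sorts the
-- values. Summed over both bits at a point, however, it yields each of the orders (a, b) and (b, a)
-- once, and these have equal sums over all a and b. Each coordinate thus contributes a factor 2.
∑∑-mix : ∀ n (o : Fin n → Bool) (H : (f g : Fin n → Fin t) → ℕ) →
  ∑ (allBits n) (λ S → ∑∑ n t (λ f g → H (mix o S f g) (mix o (¬ᵥ S) f g))) ≡ 2 ^ n * ∑∑ n t H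
∑∑-mix zero o H = refl
∑∑-mix {t} (suc n) o H = begin
  ∑ (allBits (suc n)) mixed
    ≡⟨ ∑-allBits mixed ⟩
  ∑ (allBits n) (mixed ∘ (true ∷ᵥ_)) + ∑ (allBits n) (mixed ∘ (false ∷ᵥ_))
    ≡⟨ cong₂ _+_ (face-sum true) (face-sum false) ⟩
  ∑₂ (λ a b → c * K (pick y true a b) (pick y false a b)) + ∑₂ (λ a b → c * K (pick y false a b) (pick y true a b))
    ≡⟨ ∑₂-+ _ _ ⟨
  ∑₂ (λ a b → c * K (pick y true a b) (pick y false a b) + c * K (pick y false a b) (pick y true a b))
    -- The two bits together give an expression symmetric in the two picks, so the sorting can be
    -- undone.
    ≡⟨ ∑-cong (allFin t) (λ a → ∑-cong (allFin t) (λ b →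
         pick-symmetric (λ a b → c * K a b + c * K b a) (λ a b → +-comm (c * K a b) (c * K b a)) y true a b)) ⟩
  ∑₂ (λ a b → c * K a b + c * K b a)
    ≡⟨ ∑₂-+ _ _ ⟩
  ∑₂ (λ a b → c * K a b) + ∑₂ (λ a b → c * K b a)
    ≡⟨ cong (∑₂ (λ a b → c * K a b) +_) (∑-swap (allFin t) (allFin t) (λ a b → c * K b a)) ⟩
  ∑₂ (λ a b → c * K a b) + ∑₂ (λ a b → c * K a b)
    ≡⟨ cong (λ x → x + x) (trans (∑-cong (allFin t) (λ a → ∑-*ˡ c (allFin t) (K a))) (∑-*ˡ c (allFin t) _)) ⟩
  c * ∑₂ K + c * ∑₂ K
    ≡⟨ solve 2 (λ c k → c :* k :+ c :* k := (con 2 :* c) :* k) refl c (∑₂ K) ⟩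
  2 * c * ∑₂ K
    ≡⟨ cong (2 * c *_) (∑∑-suc H) ⟨
  2 * c * ∑∑ (suc n) t H ∎
  where
  open ≡-Reasoning
  open +-*-Solver
  c = 2 ^ n
  y = o F.zero
  mixed : Bits (suc n) → ℕ
  mixed S = ∑∑ (suc n) t (λ f g → H (mix o S f g) (mix o (¬ᵥ S) f g))
  ∑₂ : (Fin t → Fin t → ℕ) → ℕ
  ∑₂ L = ∑ (allFin t) (λ a → ∑ (allFin t) (L a))
  ∑₂-+ : ∀ L L′ → ∑₂ (λ a b → L a b + L′ a b) ≡ ∑₂ L + ∑₂ L′
  ∑₂-+ L L′ = trans (∑-cong (allFin t) (λ a → ∑-+ (allFin t) (L a) (L′ a))) (∑-+ (allFin t) _ _)
  K : Fin t → Fin t → ℕ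
  K a b = ∑∑ n t (λ f g → H (a ∷ᶠ f) (b ∷ᶠ g))
  face-sum : ∀ s → ∑ (allBits n) (mixed ∘ (s ∷ᵥ_)) ≡ ∑₂ (λ a b → c * K (pick y s a b) (pick y (not s) a b))
  face-sum s = trans
    (∑-cong (allBits n) (λ S → ∑∑-suc (λ f g → H (mix o (s ∷ᵥ S) f g) (mix o (¬ᵥ (s ∷ᵥ S)) f g))))
    (trans (∑-swap (allBits n) (allFin t) _)
      (∑-cong (allFin t) (λ a → trans (∑-swap (allBits n) (allFin t) _)
        (∑-cong (allFin t) (λ b → ∑∑-mix n (o ∘ F.suc)
          (λ f g → H (pick y s a b ∷ᶠ f) (pick y (not s) a b ∷ᶠ g)))))))

-- By `∑∑-mix`, summing over the families of all pairs counts everything exactly `2 ^ n` times on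
-- either side, so it is enough to compare family by family and cancel.
∑∑-≤-from-mix : ∀ n (o : Fin n → Bool) (H H′ : (f g : Fin n → Fin t) → ℕ) →
  (∀ f g → ∑ (allBits n) (λ S → H (mix o S f g) (mix o (¬ᵥ S) f g)) ≤
           ∑ (allBits n) (λ S → H′ (mix o S f g) (mix o (¬ᵥ S) f g))) →
  ∑∑ n t H ≤ ∑∑ n t H′
∑∑-≤-from-mix {t} n o H H′ fibre-≤ = *-cancelˡ-≤ (2 ^ n) {{m^n≢0 2 n}} (begin
  2 ^ n * ∑∑ n t H
    ≡⟨ ∑∑-mix n o H ⟨
  ∑ (allBits n) (λ S → ∑∑ n t (λ f g → H (mix o S f g) (mix o (¬ᵥ S) f g)))
    ≡⟨ exchange-sums H ⟩
  ∑∑ n t (λ f g → ∑ (allBits n) (λ S → H (mix o S f g) (mix o (¬ᵥ S) f g)))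
    ≤⟨ ∑-mono (allMaps n t) (λ f → ∑-mono (allMaps n t) (fibre-≤ f)) ⟩
  ∑∑ n t (λ f g → ∑ (allBits n) (λ S → H′ (mix o S f g) (mix o (¬ᵥ S) f g)))
    ≡⟨ exchange-sums H′ ⟨
  ∑ (allBits n) (λ S → ∑∑ n t (λ f g → H′ (mix o S f g) (mix o (¬ᵥ S) f g)))
    ≡⟨ ∑∑-mix n o H′ ⟩
  2 ^ n * ∑∑ n t H′ ∎)
  where
  open ≤-Reasoning
  exchange-sums : ∀ H → ∑ (allBits n) (λ S → ∑∑ n t (λ f g → H (mix o S f g) (mix o (¬ᵥ S) f g))) ≡
    ∑∑ n t (λ f g → ∑ (allBits n) (λ S → H (mix o S f g) (mix o (¬ᵥ S) f g)))
  exchange-sums H = trans (∑-swap (allBits n) (allMaps n t) _)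
    (∑-cong (allMaps n t) (λ f → ∑-swap (allBits n) (allMaps n t) _))

-- Order constraints on mixed maps

Relation : ℕ → Set
Relation n = Fin n → Fin n → Bool

Respects : Relation n → (Fin n → Fin t) → Set
Respects R g = ∀ u v → R u v ≡ true → toℕ (g u) ≤ toℕ (g v)

andL-++ : ∀ bs cs → andL (bs ++ cs) ≡ andL bs ∧ andL cs
andL-++ [] cs = refl
andL-++ (true ∷ bs) cs = andL-++ bs cs
andL-++ (false ∷ bs) cs = refl

andL-concatMap : (h : X → List Bool) (xs : List X) → andL (concatMap h xs) ≡ andL (map (andL ∘ h) xs)
andL-concatMap h [] = refl
andL-concatMap h (x ∷ xs) = trans (andL-++ (h x) (concatMap h xs)) (cong (andL (h x) ∧_) (andL-concatMap h xs))

andL-map⁺ : (p : X → Bool) (xs : List X) → (∀ x → p x ≡ true) → andL (map p xs) ≡ true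
andL-map⁺ p [] all = refl
andL-map⁺ p (x ∷ xs) all = true-∧ (all x) (andL-map⁺ p xs all)

andL-map⁻ : (p : X → Bool) {xs : List X} → andL (map p xs) ≡ true → ∀ {x} → x ∈ xs → p x ≡ true
andL-map⁻ p eq (here refl) = proj₁ (∧-true eq)
andL-map⁻ p eq (there x∈) = andL-map⁻ p (proj₂ (∧-true eq)) x∈

respects⇒Respects : (R : Relation n) (g : Fin n → Fin t) → respects R g ≡ true → Respects R g
respects⇒Respects {n} R g eq u v Ruv =
  ≤ᵇ⇒≤ _ _ (Equivalence.from T-≡ (subst (λ r → not r ∨ (toℕ (g u) ≤ᵇ toℕ (g v)) ≡ true) Ruv
    (andL-map⁻ (entry u) (andL-map⁻ (andL ∘ row) (trans (sym (andL-concatMap row (allFin n))) eq) (∈-allFin u)) (∈-allFin v))))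
  where
  entry : Fin n → Fin n → Bool
  entry u v = not (R u v) ∨ (toℕ (g u) ≤ᵇ toℕ (g v))
  row : Fin n → List Bool
  row u = map (entry u) (allFin n)

Respects⇒respects : (R : Relation n) (g : Fin n → Fin t) → Respects R g → respects R g ≡ true
Respects⇒respects {n} R g resp =
  trans (andL-concatMap _ (allFin n)) (andL-map⁺ _ (allFin n) (λ u → andL-map⁺ _ (allFin n) (entry-true u)))
  where
  entry-true : ∀ u v → not (R u v) ∨ (toℕ (g u) ≤ᵇ toℕ (g v)) ≡ true
  entry-true u v with R u v in Ruv
  ... | true = Equivalence.to T-≡ (≤⇒≤ᵇ (resp u v Ruv))
  ... | false = refl

respects-∪⁻ : (R S : Relation n) (g : Fin n → Fin t) →
  respects (R ∪ᵣ S) g ≡ true → respects R g ≡ true × respects S g ≡ true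
respects-∪⁻ R S g eq =
    Respects⇒respects R g (λ u v r → resp u v (true-∨ˡ r))
  , Respects⇒respects S g (λ u v s → resp u v (true-∨ʳ {R u v} s))
  where resp = respects⇒Respects (R ∪ᵣ S) g eq

respects-∪⁺ : (R S : Relation n) (g : Fin n → Fin t) →
  respects R g ≡ true → respects S g ≡ true → respects (R ∪ᵣ S) g ≡ true
respects-∪⁺ R S g r s = Respects⇒respects (R ∪ᵣ S) g resp
  where
  resp : Respects (R ∪ᵣ S) g
  resp u v p with ∨-true p
  ... | inj₁ Ruv = respects⇒Respects R g r u v Ruv
  ... | inj₂ Suv = respects⇒Respects S g s u v Suv

-- Passing to the mirror image amounts to reversing the orientation. Statements about `¬ᵥ S` thereby
-- become statements about `S` with `not ∘ o`.
pick-not : ∀ y s (a b : Fin t) → pick y (not s) a b ≡ pick (not y) s a b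
pick-not true true a b = refl
pick-not true false a b = refl
pick-not false true a b = refl
pick-not false false a b = refl

-- `pick` depends on its two bits only through `y xor s`, so this one inequality settles both
-- `pick-monotone` and `pick-antitone`.
min≤max : (a b : Fin t) → toℕ (pick true false a b) ≤ toℕ (pick true true a b)
min≤max a b with toℕ a ≤ᵇ toℕ b in eq
... | true = ≤ᵇ⇒≤ _ _ (Equivalence.from T-≡ eq)
... | false = ≰⇒≥ (λ a≤b → not-¬ eq (Equivalence.to T-≡ (≤⇒≤ᵇ a≤b)))

infix 4 _⊑_

data _⊑_ : Bool → Bool → Set where
  ⊑-refl : ∀ {s} → s ⊑ s
  f⊑t : false ⊑ true

s∧t⊑s : ∀ s t → s ∧ t ⊑ s
s∧t⊑s true true = ⊑-refl
s∧t⊑s true false = f⊑t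
s∧t⊑s false t = ⊑-refl

s∧t⊑t : ∀ s t → s ∧ t ⊑ t
s∧t⊑t true t = ⊑-refl
s∧t⊑t false true = f⊑t
s∧t⊑t false false = ⊑-refl

pick-monotone : ∀ {s s′} (a b : Fin t) → s ⊑ s′ → toℕ (pick true s a b) ≤ toℕ (pick true s′ a b)
pick-monotone a b ⊑-refl = ≤-refl
pick-monotone a b f⊑t = min≤max a b

pick-antitone : ∀ {s s′} (a b : Fin t) → s ⊑ s′ → toℕ (pick false s′ a b) ≤ toℕ (pick false s a b)
pick-antitone a b ⊑-refl = ≤-refl
pick-antitone a b f⊑t = min≤max a b

-- Meeting bits takes the minimum of the picks for `y` true and the maximum for `y` false, and
-- minima and maxima preserve inequalities. `∧-sel` tells where the minimum on the right,
-- respectively the maximum on the left, is attained.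
pick-∧-≤ : ∀ y s t s′ t′ {m} (a b a′ b′ : Fin m) →
  toℕ (pick y s a b) ≤ toℕ (pick y s′ a′ b′) → toℕ (pick y t a b) ≤ toℕ (pick y t′ a′ b′) →
  toℕ (pick y (s ∧ t) a b) ≤ toℕ (pick y (s′ ∧ t′) a′ b′)
pick-∧-≤ true s t s′ t′ a b a′ b′ p q with ∧-sel s′ t′
... | inj₁ eq rewrite eq = ≤-trans (pick-monotone a b (s∧t⊑s s t)) p
... | inj₂ eq rewrite eq = ≤-trans (pick-monotone a b (s∧t⊑t s t)) q
pick-∧-≤ false s t s′ t′ a b a′ b′ p q with ∧-sel s t
... | inj₁ eq rewrite eq = ≤-trans p (pick-antitone a′ b′ (s∧t⊑s s′ t′))
... | inj₂ eq rewrite eq = ≤-trans q (pick-antitone a′ b′ (s∧t⊑t s′ t′))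

private
  𝟙*𝟙-≤ : ∀ {a b c} → (a ≡ true → b ≡ true → c ≡ true) → 𝟙 a * 𝟙 b ≤ 𝟙 c
  𝟙*𝟙-≤ {true} {true} p rewrite p refl refl = ≤-refl
  𝟙*𝟙-≤ {true} {false} p = z≤n
  𝟙*𝟙-≤ {false} p = z≤n

  𝟙-≤-𝟙*𝟙 : ∀ {a b c} → (c ≡ true → a ≡ true × b ≡ true) → 𝟙 c ≤ 𝟙 a * 𝟙 b
  𝟙-≤-𝟙*𝟙 {c = true} p with refl , refl ← p refl = ≤-refl
  𝟙-≤-𝟙*𝟙 {c = false} p = z≤n

-- The family of pairs obtained from two fixed maps

module Fibre (o : Fin n → Bool) (A : Relation n) (A-within : ∀ u v → A u v ≡ true → o u ≡ o v)
  (f g : Fin n → Fin t) where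

  -- The orientation is an argument of its own, so that `not ∘ o` can describe the mirror image.
  Ordered : Relation n → (Fin n → Bool) → Bits n → Set
  Ordered R o S = ∀ u v → R u v ≡ true →
    toℕ (pick (o u) (lookup S u) (f u) (g u)) ≤ toℕ (pick (o v) (lookup S v) (f v) (g v))

  resp : Relation n → Bits n → Bool
  resp R S = respects R (mix o S f g)

  resp⇒Ordered : ∀ {R S} → resp R S ≡ true → Ordered R o S
  resp⇒Ordered {R} {S} eq u v r = subst₂ (λ a b → toℕ a ≤ toℕ b)
    (mix-lookup o S f g u) (mix-lookup o S f g v) (respects⇒Respects R (mix o S f g) eq u v r)

  Ordered⇒resp : ∀ {R S} → Ordered R o S → resp R S ≡ true
  Ordered⇒resp {R} {S} ord = Respects⇒respects R (mix o S f g) (λ u v r → subst₂ (λ a b → toℕ a ≤ toℕ b)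
    (sym (mix-lookup o S f g u)) (sym (mix-lookup o S f g v)) (ord u v r))

  pick-¬ : ∀ S u → pick (o u) (lookup (¬ᵥ S) u) (f u) (g u) ≡ pick (not (o u)) (lookup S u) (f u) (g u)
  pick-¬ S u rewrite lookup-map u not S = pick-not (o u) (lookup S u) (f u) (g u)

  resp-¬⇒Ordered : ∀ {R S} → resp R (¬ᵥ S) ≡ true → Ordered R (not ∘ o) S
  resp-¬⇒Ordered {R} {S} eq u v r =
    subst₂ (λ a b → toℕ a ≤ toℕ b) (pick-¬ S u) (pick-¬ S v) (resp⇒Ordered {R} {¬ᵥ S} eq u v r)

  Ordered⇒resp-¬ : ∀ {R S} → Ordered R (not ∘ o) S → resp R (¬ᵥ S) ≡ true
  Ordered⇒resp-¬ {R} {S} ord = Ordered⇒resp {R} {¬ᵥ S} (λ u v r →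
    subst₂ (λ a b → toℕ a ≤ toℕ b) (sym (pick-¬ S u)) (sym (pick-¬ S v)) (ord u v r))

  -- Both ends of a constraint in `A` have the same orientation, which is the situation of
  -- `pick-∧-≤`. It is used with `o` for the map and with `not ∘ o` for its mirror image.
  Ordered-∧ : ∀ {o′ S T} → (∀ u v → A u v ≡ true → o′ u ≡ o′ v) →
    Ordered A o′ S → Ordered A o′ T → Ordered A o′ (S ∧ᵥ T)
  Ordered-∧ {o′} {S} {T} within p q u v a
    -- The two inequalities are bound before the rewriting, so that `within u v a` equates the
    -- orientations in them as well as in the goal.
    with p′ ← p u v a | q′ ← q u v a
    rewrite lookup-zipWith _∧_ u S T | lookup-zipWith _∧_ v S T | within u v a =
    pick-∧-≤ (o′ v) (lookup S u) (lookup T u) (lookup S v) (lookup T v) (f u) (g u) (f v) (g v) p′ q′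

  -- Both maps must respect `A` because `A` occurs in both factors of each product; this also makes
  -- `D` closed under complement.
  D : Bits n → Bool
  D S = resp A S ∧ resp A (¬ᵥ S)

  D-subalgebra : IsSubalgebra D
  D-subalgebra .∧-closed {S} {T} d e with ∧-true {resp A S} d | ∧-true {resp A T} e
  ... | d₁ , d₂ | e₁ , e₂ = true-∧
    (Ordered⇒resp {A} {S ∧ᵥ T} (Ordered-∧ {S = S} {T} A-within (resp⇒Ordered {A} {S} d₁) (resp⇒Ordered {A} {T} e₁)))
    (Ordered⇒resp-¬ {A} {S ∧ᵥ T} (Ordered-∧ {S = S} {T} (λ u v a → cong not (A-within u v a))
      (resp-¬⇒Ordered {A} {S} d₂) (resp-¬⇒Ordered {A} {T} e₂)))
  D-subalgebra .¬-closed {S} d with ∧-true {resp A S} d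
  ... | d₁ , d₂ = true-∧ d₂ (subst (λ S → resp A S ≡ true) (sym (¬ᵥ-involutive S)) d₁)

  ideal : Relation n → Bits n → Bool
  ideal C S = D S ∧ resp C S

  -- Clearing bits lowers values on Y and raises them on Z, so an inequality from a point of Y to a
  -- point of Z survives.
  ideal-isIdeal : ∀ {C} → (∀ u v → C u v ≡ true → o u ≡ true × o v ≡ false) → IsIdeal D (ideal C)
  ideal-isIdeal across .⊆-D {S} p = proj₁ (∧-true {D S} p)
  ideal-isIdeal {C} across .absorb {S} {T} d p with ∧-true {D T} p
  ... | e , r = true-∧ (∧-closed D-subalgebra {S} {T} d e) (Ordered⇒resp {C} {S ∧ᵥ T} ordered)
    where
    ordered : Ordered C o (S ∧ᵥ T)
    ordered u v c with ord ← resp⇒Ordered {C} {T} r u v c | ou , ov ← across u v c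
      rewrite lookup-zipWith _∧_ u S T | lookup-zipWith _∧_ v S T | ou | ov =
      ≤-trans (pick-monotone (f u) (g u) (s∧t⊑t (lookup S u) (lookup T u)))
        (≤-trans ord (pick-antitone (f v) (g v) (s∧t⊑t (lookup S v) (lookup T v))))

  -- The left side counts `S` in the ideal of `C` whose complement is in the ideal of `C′`. For `S`
  -- in both ideals, one map respects `C`, `C′` and `A`, and membership in `D` makes its mirror
  -- image respect `A`.
  fibre-≤ : ∀ {C C′} → (∀ u v → C u v ≡ true → o u ≡ true × o v ≡ false) →
    (∀ u v → C′ u v ≡ true → o u ≡ true × o v ≡ false) →
    ∑ (allBits n) (λ S → 𝟙 (resp (C ∪ᵣ A) S) * 𝟙 (resp (C′ ∪ᵣ A) (¬ᵥ S))) ≤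
    ∑ (allBits n) (λ S → 𝟙 (resp ((C ∪ᵣ C′) ∪ᵣ A) S) * 𝟙 (resp A (¬ᵥ S)))
  fibre-≤ {C} {C′} across across′ = begin
    ∑ (allBits n) (λ S → 𝟙 (resp (C ∪ᵣ A) S) * 𝟙 (resp (C′ ∪ᵣ A) (¬ᵥ S)))
      ≤⟨ ∑-mono (allBits n) (λ S → 𝟙*𝟙-≤ (to-ideals S)) ⟩
    ∑ (allBits n) (λ S → 𝟙 (ideal C S ∧ ideal C′ (¬ᵥ S)))
      ≤⟨ ∑-complement-≤ n D-subalgebra (ideal-isIdeal across) (ideal-isIdeal across′) ⟩
    ∑ (allBits n) (λ S → 𝟙 (ideal C S ∧ ideal C′ S))
      ≤⟨ ∑-mono (allBits n) (λ S → 𝟙-≤-𝟙*𝟙 (from-ideals S)) ⟩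
    ∑ (allBits n) (λ S → 𝟙 (resp ((C ∪ᵣ C′) ∪ᵣ A) S) * 𝟙 (resp A (¬ᵥ S))) ∎
    where
    open ≤-Reasoning
    to-ideals : ∀ S → resp (C ∪ᵣ A) S ≡ true → resp (C′ ∪ᵣ A) (¬ᵥ S) ≡ true → ideal C S ∧ ideal C′ (¬ᵥ S) ≡ true
    to-ideals S p q with respects-∪⁻ C A (mix o S f g) p | respects-∪⁻ C′ A (mix o (¬ᵥ S) f g) q
    ... | c , a | c′ , a′ = true-∧ (true-∧ d c) (true-∧ (¬-closed D-subalgebra {S} d) c′)
      -- Each of the two maps supplies one half of the membership of `S` in `D`.
      where d = true-∧ a a′
    from-ideals : ∀ S → ideal C S ∧ ideal C′ S ≡ true →
      resp ((C ∪ᵣ C′) ∪ᵣ A) S ≡ true × resp A (¬ᵥ S) ≡ true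
    from-ideals S p with ∧-true {ideal C S} p
    ... | u , v with ∧-true {D S} u | ∧-true {D S} v
    ... | d , c | _ , c′ with ∧-true {resp A S} d
    ... | a , a′ = respects-∪⁺ (C ∪ᵣ C′) A h (respects-∪⁺ C C′ h c c′) a , a′
      where h = mix o S f g

-- Comparison of the coefficients of the two products

theorem5p4 : (n : ℕ) (_≺_ : Rel (Fin n) 0ℓ) → IsStrictPartialOrder _≡_ _≺_ → (_≺?_ : Decidable _≺_)
    → (inY : Fin n → Bool) → (t : ℕ) → 1 ≤ t
    → (C C' : Fin n → Fin n → Bool)
    → (∀ u v → C u v ≡ true → (inY u ≡ true) × (inY v ≡ false))
    → (∀ u v → C' u v ≡ true → (inY u ≡ true) × (inY v ≡ false))
    → let A : Fin n → Fin n → Bool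
          A u v = ⌊ u ≺? v ⌋ ∧ ⌊ inY u ≟ inY v ⌋
      in (Ωq ((C ∪ᵣ C') ∪ᵣ A) t *ₚ Ωq A t) ≥q (Ωq (C ∪ᵣ A) t *ₚ Ωq (C' ∪ᵣ A) t)
theorem5p4 n _≺_ _ _≺?_ inY t _ C C' across across' k =
  subst₂ _≤_ (sym (coeff-Ωq-*ₚ (C ∪ᵣ A) (C' ∪ᵣ A) t k)) (sym (coeff-Ωq-*ₚ ((C ∪ᵣ C') ∪ᵣ A) A t k))
    (∑∑-≤-from-mix n inY (term (C ∪ᵣ A) (C' ∪ᵣ A)) (term ((C ∪ᵣ C') ∪ᵣ A) A) fibre)
  where
  open ≤-Reasoning
  A : Fin n → Fin n → Bool
  A u v = ⌊ u ≺? v ⌋ ∧ ⌊ inY u ≟ inY v ⌋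
  A-within : ∀ u v → A u v ≡ true → inY u ≡ inY v
  A-within u v a = toWitness (Equivalence.from T-≡ (proj₂ (∧-true {⌊ u ≺? v ⌋} a)))
  term : Relation n → Relation n → (f g : Fin n → Fin t) → ℕ
  term R S f g = 𝟙 (respects R f) * (𝟙 (respects S g) * coeff (mono (weight f + weight g)) k)
  module _ (f g : Fin n → Fin t) where
    open Fibre inY A A-within f g
    -- By `weight-mix` the total weight is constant on the family, so the monomial coefficient
    -- factors out and only the count treated by `fibre-≤` remains.
    constant-coeff : ∀ R R′ →
      ∑ (allBits n) (λ S → term R R′ (mix inY S f g) (mix inY (¬ᵥ S) f g)) ≡
      ∑ (allBits n) (λ S → 𝟙 (resp R S) * 𝟙 (resp R′ (¬ᵥ S))) * coeff (mono (weight f + weight g)) k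
    constant-coeff R R′ = trans
      (∑-cong (allBits n) (λ S → trans
        (cong (λ w → 𝟙 (resp R S) * (𝟙 (resp R′ (¬ᵥ S)) * coeff (mono w) k)) (weight-mix inY S f g))
        (sym (*-assoc (𝟙 (resp R S)) (𝟙 (resp R′ (¬ᵥ S))) _))))
      (∑-*ʳ _ (allBits n) _)
    fibre : ∑ (allBits n) (λ S → term (C ∪ᵣ A) (C' ∪ᵣ A) (mix inY S f g) (mix inY (¬ᵥ S) f g)) ≤
      ∑ (allBits n) (λ S → term ((C ∪ᵣ C') ∪ᵣ A) A (mix inY S f g) (mix inY (¬ᵥ S) f g))
    fibre = begin
      _ ≡⟨ constant-coeff (C ∪ᵣ A) (C' ∪ᵣ A) ⟩
      _ ≤⟨ *-monoˡ-≤ (coeff (mono (weight f + weight g)) k) (fibre-≤ across across') ⟩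
      _ ≡⟨ constant-coeff ((C ∪ᵣ C') ∪ᵣ A) A ⟨
      _ ∎
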